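{- Let $\mathbf A$ be a structure, and let $v$ be a game vector. The following are equivalent. 1. The $v$-game solves $p\text{ - }\mathrm{HOM}(\{\mathbf A\})$. 2. The graph $\mathrm{graph}(\mathrm{core}(\mathbf A))$ has a $v$-decomposition.
   Context: Structures are finite relational structures over finite vocabularies with non-empty universe; similar structures have the same vocabulary. A partial homomorphism from $\mathbf A$ to $\mathbf B$ is either the empty map or a homomorphism to $\mathbf B$ from the substructure of $\mathbf A$ induced on a non-empty set $\mathrm{dom}(h)\subseteq A$. A structure is a core if all its homomorphisms to itself are injective; $\mathrm{core}(\mathbf A)$ is the (unique up to isomorphism) core $\mathbf B$ with $B\subseteq A$, $R^{\mathbf B}\subseteq R^{\mathbf A}$ for all relation symbols $R$, and such that $\mathbf A$ has a homomorphism to $\mathbf B$. $\mathrm{graph}(\mathbf A)$ is the Gaifman graph: vertex set $A$, an edge between distinct $a,a'$ iff they occur together in a tuple of some relation of $\mathbf A$. A game vector is a tuple $v=(p_1,\ldots,p_r)\in\mathbb N^r$ with $r\ge1$ (here $0\in\mathbb N$). A Duplicator winning strategy for the $v$-game on a pair $(\mathbf A,\mathbf B)$ of similar structures is a sequence $(W_1,\ldots,W_r)$ of sets of partial homomorphisms from $\mathbf A$ to $\mathbf B$ such that: for all $S\subseteq A$ with $|S|\le p_1$, $W_1$ contains a mapping with domain $S$; and for all $1\le i\le r-1$, all $g\in W_i$ and all $S$ with $\mathrm{dom}(g)\subseteq S\subseteq A$ and $|S\setminus\mathrm{dom}(g)|\le p_{i+1}$, there is an extension $g'\in W_{i+1}$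 of $g$ with domain $S$. For a class of structures $\mathcal A$, $p\text{ - }\mathrm{HOM}(\mathcal A)$ is the problem of deciding, given $\mathbf A\in\mathcal A$ (the parameter) and a structure $\mathbf B$ similar to $\mathbf A$, whether there is a homomorphism from $\mathbf A$ to $\mathbf B$. The $v$-game solves $p\text{ - }\mathrm{HOM}(\mathcal A)$ if for every $\mathbf A\in\mathcal A$ and every $\mathbf B$ similar to $\mathbf A$, the existence of a Duplicator winning strategy for the $v$-game on $(\mathbf A,\mathbf B)$ implies that there is a homomorphism from $\mathbf A$ to $\mathbf B$. For graphs $\mathbf G,\mathbf H$, an $\mathbf H$-decomposition of $\mathbf G$ is a family $(B_h)_{h\in H}$ of subsets of $G$ such that every vertex of $\mathbf G$ lies in some $B_h$, for every edge $(g,g')$ of $\mathbf G$ there is $h$ with $\{g,g'\}\subseteq B_h$, and for each $g\in G$ the set $\{h\mid g\in B_h\}$ is connected in $\mathbf H$. A $v$-decomposition of $\mathbf G$ is an $\mathbf H$-decomposition $(B_h)_{h\in H}$ where $\mathbf H$ is a rooted forest (each component has a root) of height $<r$ (every path from a root has fewer than $r$ edges), $|B_h|\le p_1$ for all $h$ at level $1$, and $B_h\subseteq B_{h'}$ and $|B_{h'}\setminus B_h|\le p_{i+1}$ for all adjacent nodes $h,h'$ at levels $i$ and $i+1$, respectively. The level of a node is the number of vertices on the path to it from the root of its component (roots have level 1).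
   Formalization: The case where v = (0,…,0) and all relations of A are empty is excluded: there every structure B admits a homomorphism from A, so (1) holds, but all bags are empty and the single vertex of core(A) is not covered, so (2) fails. -}

module Defs where

open import Data.Bool using (Bool; T; T?)
open import Data.Fin using (Fin; zero; suc; inject₁; toℕ; punchIn; punchOut)
open import Data.Fin.Properties using (_≟_; any?; all?; ¬∀⟶∃¬; punchIn-punchOut;
  punchIn-injective; punchOut-injective; injective⇒≤)
open import Data.Fin.Subset using (Subset; ∣_∣; _∈_; _⊆_; _─_; Empty)
open import Data.List using (List; []; _∷_; length)
open import Data.List.Relation.Unary.Unique.Propositional using (Unique)
open import Data.Maybe using (Maybe; just; is-just)
open import Data.Nat using (ℕ; zero; suc; _≤_; _<_; NonZero)
open import Data.Nat.Properties using (1+n≰n)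
open import Data.Product using (Σ; ∃; ∃₂; ∃!; _×_; _,_; proj₁; proj₂)
open import Data.Sum using (_⊎_)
open import Data.Vec as Vec using (Vec; []; _∷_; lookup; tabulate)
import Data.Vec.Membership.DecPropositional as DecMembership
open import Data.Vec.Membership.Propositional using () renaming (_∈_ to _∈ᵛ_)
open import Data.Vec.Properties using (map-id; map-∘; map-cong; lookup∘tabulate)
open import Data.Vec.Relation.Binary.Pointwise.Inductive using (Pointwise)
open import Function using (_∘_)
open import Function.Definitions using (Injective)
open import Level using (Level; 0ℓ) renaming (suc to lsuc; _⊔_ to _⊔ℓ_)
open import Relation.Binary using (Rel; Symmetric; Irreflexive)
import Relation.Binary as B
open import Relation.Binary.Construct.Closure.ReflexiveTransitive using (Star; ε; _◅_)
open import Relation.Binary.PropositionalEquality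
open import Relation.Nullary using (Dec; yes; no; ¬_; contradiction)
open import Relation.Nullary.Decidable using (map′; ¬?; _×-dec_; _→-dec_; decidable-stable)
open import Relation.Unary using (Pred; Decidable)

-- Symbols of arity 0 are allowed.
record Vocabulary : Set where
  field
    symbols : ℕ
    arity   : Fin symbols → ℕ

  Symbol : Set
  Symbol = Fin symbols

open Vocabulary public

record Structure (σ : Vocabulary) : Set where
  field
    size     : ℕ
    nonEmpty : NonZero size
    rel      : (R : Symbol σ) → Vec (Fin size) (arity σ R) → Bool

  Universe : Set
  Universe = Fin size

open Structure public using (Universe)

private
  variable
    σ : Vocabulary

infix 4 _⊨_⟨_⟩

_⊨_⟨_⟩ : (A : Structure σ) (R : Symbol σ) → Vec (Universe A) (arity σ R) → Set
A ⊨ R ⟨ t ⟩ = T (Structure.rel A R t)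

IsHom : (A B : Structure σ) → (Universe A → Universe B) → Set
IsHom A B f = ∀ R t → A ⊨ R ⟨ t ⟩ → B ⊨ R ⟨ Vec.map f t ⟩

Hom : (A B : Structure σ) → Set
Hom A B = ∃ (IsHom A B)

IsCore : Structure σ → Set
IsCore A = ∀ f → IsHom A A f → Injective _≡_ _≡_ f

-- The inclusions of universe and relations are expressed by an injective
-- homomorphism (not necessarily an embedding), so that C is a substructure
-- of A in the weak sense up to renaming of its elements.
record _IsCoreOf_ (C A : Structure σ) : Set where
  field
    isCore      : IsCore C
    ι           : Universe C → Universe A
    ι-isHom     : IsHom C A ι
    ι-injective : Injective _≡_ _≡_ ι
    retraction  : Hom A C

PartialMap : (A B : Structure σ) → Set
PartialMap A B = Vec (Maybe (Universe B)) (Structure.size A)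

module _ {A B : Structure σ} where

  dom : PartialMap A B → Subset (Structure.size A)
  dom = Vec.map is-just

  Maps : PartialMap A B → Universe A → Universe B → Set
  Maps h a b = lookup h a ≡ just b

  Extends : (g g′ : PartialMap A B) → Set
  Extends g g′ = ∀ a b → Maps g a b → Maps g′ a b

  -- The empty map needs its own clause because of symbols of arity 0.
  IsPartialHom : PartialMap A B → Set
  IsPartialHom h = Empty (dom h) ⊎
    (∀ R t u → Pointwise (Maps h) t u → A ⊨ R ⟨ t ⟩ → B ⊨ R ⟨ u ⟩)

-- A game vector (p₁ , … , pᵣ) with r = suc k; pᵢ₊₁ is the entry at index i.
GameVector : ℕ → Set
GameVector k = Vec ℕ (suc k)

record WinningStrategy {k} (v : GameVector k) (A B : Structure σ) : Set₁ where
  field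
    W          : Fin (suc k) → Pred (PartialMap A B) 0ℓ
    partialHom : ∀ i h → W i h → IsPartialHom {A = A} {B} h
    start      : ∀ S → ∣ S ∣ ≤ lookup v zero →
                 ∃ λ h → W zero h × dom {A = A} {B} h ≡ S
    extend     : ∀ (i : Fin k) g S → W (inject₁ i) g → dom {A = A} {B} g ⊆ S →
                 ∣ S ─ dom {A = A} {B} g ∣ ≤ lookup v (suc i) →
                 ∃ λ g′ → W (suc i) g′ × Extends {A = A} {B} g g′ ×
                          dom {A = A} {B} g′ ≡ S

StructureClass : (ℓ : Level) → Set (lsuc ℓ)
StructureClass ℓ = Pred (∃ Structure) ℓ

Solves-p-HOM : ∀ {k ℓ} → GameVector k → StructureClass ℓ → Set (lsuc 0ℓ ⊔ℓ ℓ)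
Solves-p-HOM v 𝒜 = ∀ τ (A : Structure τ) → 𝒜 (τ , A) →
                   ∀ (B : Structure τ) → WinningStrategy v A B → Hom A B

-- Excludes exactly the case where v = (0 , … , 0) and all relations of A are
-- empty: there every B admits a homomorphism from A, whereas no non-empty graph
-- is covered by empty bags.
NonDegenerate : ∀ {k} → GameVector k → Structure σ → Set
NonDegenerate v A = (∃ λ i → lookup v i ≢ 0) ⊎ (∃₂ λ R t → A ⊨ R ⟨ t ⟩)

record Graph : Set₁ where
  field
    order       : ℕ
    nonEmpty    : NonZero order
    Adj         : Rel (Fin order) 0ℓ
    adj?        : B.Decidable Adj
    symmetric   : Symmetric Adj
    irreflexive : Irreflexive _≡_ Adj

  Vertex : Set
  Vertex = Fin order

  Walk : Rel Vertex 0ℓ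
  Walk = Star Adj

  vertices : ∀ {x y} → Walk x y → List Vertex
  vertices {x} ε       = x ∷ []
  vertices {x} (_ ◅ w) = x ∷ vertices w

  edgeCount : ∀ {x y} → Walk x y → ℕ
  edgeCount ε       = 0
  edgeCount (_ ◅ w) = suc (edgeCount w)

  IsPath : ∀ {x y} → Walk x y → Set
  IsPath w = Unique (vertices w)

  -- A cycle is a path with at least two edges whose ends are adjacent.
  Acyclic : Set
  Acyclic = ∀ {x y} (w : Walk x y) → IsPath w → 2 ≤ edgeCount w → ¬ Adj y x

  Connected : ∀ {ℓ} → Pred Vertex ℓ → Set ℓ
  Connected P = ∀ {x y} → P x → P y → Star (λ a b → Adj a b × P a × P b) x y

record RootedForest : Set₁ where
  field
    graph : Graph

  open Graph graph public

  field
    acyclic : Acyclic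
    roots   : Subset order
    rooted  : ∀ x → ∃! _≡_ λ ρ → ρ ∈ roots × Walk ρ x

  HeightLessThan : ℕ → Set
  HeightLessThan r = ∀ {ρ x} → ρ ∈ roots → (w : Walk ρ x) → IsPath w → edgeCount w < r

  HasLevel : Vertex → ℕ → Set
  HasLevel x l = ∃ λ ρ → ρ ∈ roots × Σ (Walk ρ x) λ w → IsPath w × length (vertices w) ≡ l

record IsDecomposition (H G : Graph)
                       (bag : Graph.Vertex H → Subset (Graph.order G)) : Set where
  field
    coversVertices : ∀ g → ∃ λ h → g ∈ bag h
    coversEdges    : ∀ g g′ → Graph.Adj G g g′ → ∃ λ h → g ∈ bag h × g′ ∈ bag h
    connected      : ∀ g → Graph.Connected H (λ h → g ∈ bag h)

record VDecomposition {k} (v : GameVector k) (G : Graph) : Set₁ where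
  field
    forest : RootedForest

  open RootedForest forest

  field
    height          : HeightLessThan (suc k)
    bag             : Vertex → Subset (Graph.order G)
    isDecomposition : IsDecomposition graph G bag
    rootBag         : ∀ h → HasLevel h 1 → ∣ bag h ∣ ≤ lookup v zero
    -- The index i : Fin k stands for the levels toℕ i + 1 and toℕ i + 2.
    childBag        : ∀ (i : Fin k) h h′ → Adj h h′ →
                      HasLevel h (suc (toℕ i)) → HasLevel h′ (suc (suc (toℕ i))) →
                      bag h ⊆ bag h′ × ∣ bag h′ ─ bag h ∣ ≤ lookup v (suc i)

anyVec? : ∀ {n k ℓ} {P : Pred (Vec (Fin n) k) ℓ} → Decidable P → Dec (∃ P)
anyVec? {k = zero}  P? = map′ ([] ,_) (λ { ([] , p) → p }) (P? [])
anyVec? {k = suc _} P? =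
  map′ (λ { (x , xs , p) → (x ∷ xs) , p }) (λ { (x ∷ xs , p) → x , xs , p })
       (any? λ x → anyVec? λ xs → P? (x ∷ xs))

allVec? : ∀ {n k ℓ} {P : Pred (Vec (Fin n) k) ℓ} → Decidable P → Dec (∀ t → P t)
allVec? P? = map′ (λ ¬∃ t → decidable-stable (P? t) λ ¬p → ¬∃ (t , ¬p))
                  (λ p (t , ¬p) → ¬p (p t))
                  (¬? (anyVec? λ t → ¬? (P? t)))

gaifman : Structure σ → Graph
gaifman A = record
  { order       = Structure.size A
  ; nonEmpty    = Structure.nonEmpty A
  ; Adj         = λ a a′ → a ≢ a′ × ∃₂ λ R t → A ⊨ R ⟨ t ⟩ × a ∈ᵛ t × a′ ∈ᵛ t
  ; adj?        = λ a a′ → ¬? (a ≟ a′) ×-dec any? λ R → anyVec? λ t →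
                    T? (Structure.rel A R t) ×-dec a ∈ᵛ? t ×-dec a′ ∈ᵛ? t
  ; symmetric   = λ (a≢a′ , R , t , r , a∈t , a′∈t) → a≢a′ ∘ sym , R , t , r , a′∈t , a∈t
  ; irreflexive = λ a≡a′ (a≢a′ , _) → a≢a′ a≡a′
  }
  where open DecMembership _≟_ renaming (_∈?_ to _∈ᵛ?_)

private

  isHom? : (A B : Structure σ) → Decidable (IsHom A B)
  isHom? A B f = all? λ R → allVec? λ t →
    T? (Structure.rel A R t) →-dec T? (Structure.rel B R (Vec.map f t))

  isHom-cong : (A B : Structure σ) {f g : Universe A → Universe B} →
               (∀ a → f a ≡ g a) → IsHom A B f → IsHom A B g
  isHom-cong A B f≗g hom R t = subst (B ⊨ R ⟨_⟩) (map-cong f≗g t) ∘ hom R t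

  isHom-∘ : (A B C : Structure σ) {f : Universe A → Universe B} {g : Universe B → Universe C} →
            IsHom A B f → IsHom B C g → IsHom A C (g ∘ f)
  isHom-∘ A B C {f} {g} hf hg R t r =
    subst (C ⊨ R ⟨_⟩) (sym (map-∘ g f t)) (hg R (Vec.map f t) (hf R t r))

  surjective⇒injective : ∀ {n} (f : Fin n → Fin n) → (∀ b → ∃ λ a → f a ≡ b) → Injective _≡_ _≡_ f
  surjective⇒injective {suc n} f surj {i} {j} fi≡fj with i ≟ j
  ... | yes i≡j = i≡j
  ... | no  i≢j = contradiction (missed (g (f i) ≟ i)) λ (c , miss) →
    1+n≰n (injective⇒≤ {f = λ b → punchOut (miss b)}
      λ {x} {y} eq → g-injective (punchOut-injective (miss x) (miss y) eq))
    where
    g = proj₁ ∘ surj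
    g-injective : Injective _≡_ _≡_ g
    g-injective {x} {y} eq = trans (sym (proj₂ (surj x))) (trans (cong f eq) (proj₂ (surj y)))
    section : ∀ {c b} → c ≡ g b → g (f c) ≡ c
    section {b = b} refl = cong g (proj₂ (surj b))
    missed : Dec (g (f i) ≡ i) → ∃ λ c → ∀ b → c ≢ g b
    missed (yes p) = j , λ b eq → i≢j (trans (sym p) (trans (cong g fi≡fj) (section eq)))
    missed (no ¬p) = i , λ b eq → ¬p (section eq)

  -- An endomorphism missing an element b of A.
  Misses : (A : Structure σ) → Pred (Vec (Universe A) (Structure.size A)) 0ℓ
  Misses A f = IsHom A A (lookup f) × ∃ λ b → ∀ a → b ≢ lookup f a

  misses? : (A : Structure σ) → Decidable (Misses A)
  misses? A f = isHom? A A (lookup f) ×-dec any? λ b → all? λ a → ¬? (b ≟ lookup f a)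

  isCore : (A : Structure σ) → ¬ ∃ (Misses A) → IsCore A
  isCore A ¬miss f hom = surjective⇒injective f λ b →
    decidable-stable (any? λ a → f a ≟ b) λ ¬hit →
      ¬miss (tabulate f , isHom-cong A A (sym ∘ lookup∘tabulate f) hom , b ,
             λ a eq → ¬hit (a , trans (sym (lookup∘tabulate f a)) (sym eq)))

  coreBySize : ∀ n (A : Structure σ) → Structure.size A ≡ n → ∃ (_IsCoreOf A)
  coreBySize n A eq with anyVec? (misses? A)
  ... | no ¬miss = A , record
    { isCore = isCore A ¬miss ; ι = λ a → a ; ι-isHom = idHom ; ι-injective = λ p → p
    ; retraction = (λ a → a) , idHom }
    where
    idHom : IsHom A A (λ a → a)
    idHom R t = subst (A ⊨ R ⟨_⟩) (sym (map-id t))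
  coreBySize (suc n) A@(record { size = suc n }) refl | yes (f , hom , b , miss) =
    C , record
      { isCore      = _IsCoreOf_.isCore C-core
      ; ι           = punchIn b ∘ ι
      ; ι-isHom     = isHom-∘ C A′ A ι-isHom (λ _ _ r → r)
      ; ι-injective = λ p → ι-injective (punchIn-injective b _ _ p)
      ; retraction  = proj₁ retraction ∘ f′ , isHom-∘ A A′ C f′-isHom (proj₂ retraction)
      }
    where
    f′ : Fin (suc n) → Fin n
    f′ a = punchOut (miss a)
    A′ : Structure _
    A′ = record
      { size     = n
      ; nonEmpty = inhabited (f′ zero)
      ; rel      = λ R t → Structure.rel A R (Vec.map (punchIn b) t)
      }
      where
      inhabited : ∀ {m} → Fin m → NonZero m
      inhabited {suc _} _ = _
    f′-isHom : IsHom A A′ f′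
    f′-isHom R t r = subst (A ⊨ R ⟨_⟩)
      (trans (map-cong (λ a → sym (punchIn-punchOut (miss a))) t) (map-∘ (punchIn b) f′ t))
      (hom R t r)
    rec = coreBySize n A′ refl
    C = proj₁ rec
    C-core = proj₂ rec
    open _IsCoreOf_ C-core using (ι; ι-isHom; ι-injective; retraction)
  coreBySize zero (record { size = zero ; nonEmpty = () }) refl | yes _

-- Cores are referred to through _IsCoreOf_; this shows the notion is never vacuous.
core-exists : (A : Structure σ) → ∃ (_IsCoreOf A)
core-exists A = coreBySize _ A refl

{-# OPTIONS --safe #-}
module Submission where

-- If graph(C) has a v-decomposition, Duplicator's answers along the forest, each extending the one
-- at the parent node, agree on common elements because the bags of an element are connected; their
-- union is a homomorphism because the elements of a tuple, being pairwise in common bags, have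
-- comparable topmost nodes, so that the bag of the deepest of these contains them all.
--
-- Conversely, let B consist of the pairs (c , s) of an element c of C and a sequence s of Spoiler
-- moves the last of which adds c; tuples of B are tuples of C whose sequences are pairwise
-- comparable in the prefix order.  Duplicator wins on (C , B) by recording when an element was
-- added.  Followed by the projection to C, a homomorphism f : C → B is injective as C is a core, so
-- the bags { c ∣ the sequence of f c is a prefix of s }, over the forest of all sequences s, are as
-- small as Spoiler's moves.

open import Defs
open import Data.Bool using (T?; false)
import Data.Bool.Properties as Boolₚ
open import Data.Empty using () renaming (⊥ to Falsum)
open import Data.Fin using (Fin; zero; suc; inject₁; toℕ; fromℕ<)
open import Data.Fin.Properties
  using (_≟_; any?; all?; toℕ-injective; toℕ-inject₁; toℕ-fromℕ<; toℕ<n)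
open import Data.Fin.Subset
  using (Subset; Side; inside; outside; ⊥; ⁅_⁆; ∣_∣; _∈_; _∉_; _⊆_; _─_; _-_; Empty; Nonempty)
open import Data.Fin.Subset.Properties
  using (_∈?_; nonempty?; Empty-unique; ∉⊥; ∣⊥∣≡0; x∈⁅x⁆; ∣⁅x⁆∣≡1; p─⊥≡p; p─q⊆p; ∣p─q∣≤∣p∣;
         x∈p⇒∣p-x∣<∣p∣; x∈p∧x∉q⇒x∈p─q; ⊆-antisym)
open import Data.List as List
  using (List; []; _∷_; length; cartesianProductWith; cartesianProduct; allFin; filter; deduplicate;
         replicate)
open import Data.List.Membership.DecPropositional using () renaming (_∈?_ to ∈ˡ-dec)
open import Data.List.Membership.Propositional using () renaming (_∈_ to _∈ˡ_; _∉_ to _∉ˡ_)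
open import Data.List.Membership.Propositional.Properties
  using (∈-cartesianProductWith⁺; ∈-cartesianProductWith⁻; ∈-cartesianProduct⁺; ∈-cartesianProduct⁻;
         ∈-filter⁺; ∈-filter⁻; ∈-deduplicate⁺; ∈-deduplicate⁻; ∈-lookup; ∈-allFin)
import Data.List.Properties as Listₚ
open import Data.List.Relation.Unary.All as All using (All; []; _∷_)
open import Data.List.Relation.Unary.All.Properties using (¬Any⇒All¬; All¬⇒¬Any)
open import Data.List.Relation.Unary.AllPairs as AllPairs using ([]; _∷_)
open import Data.List.Relation.Unary.Any as Any using (here; there)
open import Data.List.Relation.Unary.Any.Properties using (lookup-index)
import Data.List.Relation.Unary.Unique.DecPropositional.Properties as DecUnique
open import Data.List.Relation.Unary.Unique.Propositional using (Unique)
open import Data.Maybe using (Maybe; just; nothing; is-just)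
open import Data.Nat as ℕ using (ℕ; zero; suc; pred; _+_; _≤_; _<_; z≤n; s≤s; NonZero)
open import Data.Nat.Properties as ℕₚ
  using (+-identityʳ; +-suc; +-assoc; +-comm; ≤-trans; ≤-reflexive; m≢1+m+n; suc-injective;
         ≡-irrelevant)
open import Data.Product using (Σ; ∃; ∃₂; _×_; _,_; proj₁; proj₂)
open import Data.Sum as Sum using (_⊎_; inj₁; inj₂; swap)
open import Data.Unit using (⊤; tt)
open import Data.Vec as Vec using (Vec; []; _∷_; here; there; lookup; tabulate)
open import Data.Vec.Membership.Propositional using () renaming (_∈_ to _∈ᵛ_)
open import Data.Vec.Properties
  using ([]=⇒lookup; lookup⇒[]=; lookup∘tabulate; lookup-map; lookup-replicate; map-id; map-∘;
         map-replicate; ≡-dec)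
open import Data.Vec.Relation.Binary.Pointwise.Inductive as Pointwise using (Pointwise; []; _∷_)
open import Data.Vec.Relation.Unary.Any as Anyᵛ using (here; there)
import Data.Vec.Relation.Unary.Any.Properties as Anyᵛₚ
open import Function using (_∘_; flip)
open import Function.Bundles using (_⇔_; mk⇔)
open import Function.Definitions using (Injective)
open import Level using (0ℓ)
import Relation.Binary as B
open import Relation.Binary using (Rel; DecidableEquality)
open import Relation.Binary.Construct.Closure.ReflexiveTransitive as Star
  using (Star; ε; _◅_; _◅◅_)
open import Relation.Binary.PropositionalEquality
open import Relation.Nullary using (Dec; yes; no; does; ¬_; contradiction)
open import Relation.Nullary.Decidable
  using (_×-dec_; _⊎-dec_; ¬?; ⌊_⌋; toWitness; fromWitness; map′; dec-true; decidable-stable)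
open import Relation.Unary using (Pred; Decidable; ｛_｝)

private variable
  X : Set
  σ : Vocabulary

-- Cardinalities of subsets

comprehension : ∀ {n} {P : Pred (Fin n) 0ℓ} → Decidable P → Subset n
comprehension P? = tabulate (does ∘ P?)

∈-comprehension⁺ : ∀ {n} {P : Pred (Fin n) 0ℓ} (P? : Decidable P) {x} → P x → x ∈ comprehension P?
∈-comprehension⁺ P? {x} px =
  lookup⇒[]= x _ (trans (lookup∘tabulate _ x) (dec-true (P? x) px))

∈-comprehension⁻ : ∀ {n} {P : Pred (Fin n) 0ℓ} (P? : Decidable P) {x} → x ∈ comprehension P? → P x
∈-comprehension⁻ P? {x} x∈ with P? x | trans (sym (lookup∘tabulate (does ∘ P?) x)) ([]=⇒lookup x∈)
... | yes px | _ = px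
... | no  _  | ()

∣p∣≤1+∣p-x∣ : ∀ {n} (p : Subset n) x → ∣ p ∣ ≤ suc ∣ p - x ∣
∣p∣≤1+∣p-x∣ (inside  ∷ p) zero    = s≤s (≤-reflexive (cong ∣_∣ (sym (p─⊥≡p p))))
∣p∣≤1+∣p-x∣ (outside ∷ p) zero    = ≤-trans (≤-reflexive (cong ∣_∣ (sym (p─⊥≡p p)))) (ℕₚ.n≤1+n _)
∣p∣≤1+∣p-x∣ (inside  ∷ p) (suc x) = s≤s (∣p∣≤1+∣p-x∣ p x)
∣p∣≤1+∣p-x∣ (outside ∷ p) (suc x) = ∣p∣≤1+∣p-x∣ p x

x∈p─q⇒x∉q : ∀ {n} (p q : Subset n) {x} → x ∈ p ─ q → x ∉ q
x∈p─q⇒x∉q (inside  ∷ p) (inside ∷ q) () here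
x∈p─q⇒x∉q (outside ∷ p) (inside ∷ q) () here
x∈p─q⇒x∉q (_ ∷ p) (inside  ∷ q) (there x∈) (there x∈q) = x∈p─q⇒x∉q p q x∈ x∈q
x∈p─q⇒x∉q (_ ∷ p) (outside ∷ q) (there x∈) (there x∈q) = x∈p─q⇒x∉q p q x∈ x∈q

-- R is a partial function from p onto q, which covers both images under a map and injections of q
-- into p.
∣image∣≤ : ∀ {m n} (R : Fin m → Fin n → Set) → (∀ x y → Dec (R x y)) →
           (∀ {x y y′} → R x y → R x y′ → y ≡ y′) →
           (p : Subset m) (q : Subset n) → (∀ {y} → y ∈ q → ∃ λ x → x ∈ p × R x y) →
           ∣ q ∣ ≤ ∣ p ∣
∣image∣≤ {n = n} R R? functional [] q f = ≤-reflexive (trans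
  (cong ∣_∣ (Empty-unique {p = q} λ (_ , y∈) → contradiction (proj₁ (f y∈)) λ ())) (∣⊥∣≡0 n))
∣image∣≤ R R? functional (inside ∷ p) q f with any? (λ y → y ∈? q ×-dec R? zero y)
-- By functionality `zero` is related to `y` alone, so it pays for removing `y` from `q`, and the
-- rest of `q` is reached from the rest of `p`.
... | yes (y , y∈q , r) = ≤-trans (∣p∣≤1+∣p-x∣ q y)
  (s≤s (∣image∣≤ (R ∘ suc) (R? ∘ suc) functional p (q - y) λ z∈ → lower z∈ (f (p─q⊆p q ⁅ y ⁆ z∈))))
  where
  lower : ∀ {z} → z ∈ q - y → (∃ λ x → x ∈ inside ∷ p × R x z) → ∃ λ x → x ∈ p × R (suc x) z
  lower z∈ (zero  , _ , r′)        = contradiction (functional r r′) λ { refl → x∈p─q⇒x∉q q _ z∈ (x∈⁅x⁆ y) }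
  lower _  (suc x , there x∈ , r′) = x , x∈ , r′
... | no ¬r = ≤-trans
  (∣image∣≤ (R ∘ suc) (R? ∘ suc) functional p q λ y∈ → lower y∈ (f y∈)) (ℕₚ.n≤1+n _)
  where
  lower : ∀ {z} → z ∈ q → (∃ λ x → x ∈ inside ∷ p × R x z) → ∃ λ x → x ∈ p × R (suc x) z
  lower z∈ (zero  , _ , r)        = contradiction (_ , z∈ , r) ¬r
  lower _  (suc x , there x∈ , r) = x , x∈ , r
∣image∣≤ R R? functional (outside ∷ p) q f =
  ∣image∣≤ (R ∘ suc) (R? ∘ suc) functional p q λ y∈ → lower (f y∈)
  where
  lower : ∀ {z} → (∃ λ x → x ∈ outside ∷ p × R x z) → ∃ λ x → x ∈ p × R (suc x) z
  lower (suc x , there x∈ , r) = x , x∈ , r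

inhabitant : ∀ {n} → NonZero n → Fin n
inhabitant {suc _} _ = zero

module _ {m n} (f : Fin m → Fin n) where

  image? : ∀ S → Decidable λ c → ∃ λ a → a ∈ S × f a ≡ c
  image? S c = any? λ a → a ∈? S ×-dec f a ≟ c

  image : Subset m → Subset n
  image S = comprehension (image? S)

  ∈-image⁺ : ∀ {S a} → a ∈ S → f a ∈ image S
  ∈-image⁺ {S} a∈ = ∈-comprehension⁺ (image? S) (_ , a∈ , refl)

  ∈-image⁻ : ∀ {S c} → c ∈ image S → ∃ λ a → a ∈ S × f a ≡ c
  ∈-image⁻ {S} = ∈-comprehension⁻ (image? S)

  ∣image∣ : ∀ S → ∣ image S ∣ ≤ ∣ S ∣
  ∣image∣ S = ∣image∣≤ (λ a c → f a ≡ c) (λ a c → f a ≟ c)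
    (λ eq eq′ → trans (sym eq) eq′) S (image S) ∈-image⁻

  -- No preimage of an element outside `image T` lies in `T`. This bounds the elements newly asked
  -- for when a Spoiler move is carried along a homomorphism.
  ∣image─image∣ : ∀ S T → ∣ image S ─ image T ∣ ≤ ∣ S ─ T ∣
  ∣image─image∣ S T = ∣image∣≤ (λ a c → f a ≡ c) (λ a c → f a ≟ c)
    (λ eq eq′ → trans (sym eq) eq′) (S ─ T) (image S ─ image T) λ c∈ →
      let a , a∈S , fa≡c = ∈-image⁻ (p─q⊆p (image S) (image T) c∈) in
      a , x∈p∧x∉q⇒x∈p─q a∈S (λ a∈T → x∈p─q⇒x∉q (image S) (image T) c∈
        (subst (_∈ image T) fa≡c (∈-image⁺ a∈T))) , fa≡c

-- Walks and levels in forests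

module GraphWalks (G : Graph) where
  open Graph G

  Within : Pred Vertex 0ℓ → Rel Vertex 0ℓ
  Within P x y = Adj x y × P x × P y

  _∈ˡ?_ : ∀ (x : Vertex) xs → Dec (x ∈ˡ xs)
  _∈ˡ?_ = ∈ˡ-dec _≟_

  length-vertices : ∀ {x y} (w : Walk x y) → length (vertices w) ≡ suc (edgeCount w)
  length-vertices ε       = refl
  length-vertices (_ ◅ w) = cong suc (length-vertices w)

  source∈ : ∀ {x y} (w : Walk x y) → x ∈ˡ vertices w
  source∈ ε       = here refl
  source∈ (_ ◅ _) = here refl

  target∈ : ∀ {x y} (w : Walk x y) → y ∈ˡ vertices w
  target∈ ε       = here refl
  target∈ (_ ◅ w) = there (target∈ w)

  edgeCount≡0 : ∀ {x y} (w : Walk x y) → edgeCount w ≡ 0 → x ≡ y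
  edgeCount≡0 ε _ = refl

  within : ∀ {P x y} (w : Walk x y) → All P (vertices w) → Star (Within P) x y
  within ε       _         = ε
  within (e ◅ w) (px ∷ ps) = (e , px , All.lookup ps (source∈ w)) ◅ within w ps

  within-reverse : ∀ {P x y} → Star (Within P) x y → Star (Within P) y x
  within-reverse = Star.reverse λ (e , px , py) → symmetric e , py , px

  -- Quantifying over `P` expresses that both halves only visit vertices of `w`, in the form in
  -- which proofs of avoidance and of `IsPath` use it.
  split : ∀ {x y z} (w : Walk x z) → y ∈ˡ vertices w →
          Σ (Walk x y) λ a → Σ (Walk y z) λ b →
          edgeCount w ≡ edgeCount a + edgeCount b ×
          (∀ {P : Pred Vertex 0ℓ} → All P (vertices w) → All P (vertices a) × All P (vertices b)) ×
          (IsPath w → IsPath a × IsPath b)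
  split ε (here refl) = ε , ε , refl , (λ ps → ps , ps) , λ u → u , u
  split (e ◅ w) (here refl) =
    ε , e ◅ w , refl , (λ { (p ∷ ps) → p ∷ [] , p ∷ ps }) , λ u → [] ∷ [] , u
  split (e ◅ w) (there i) with a , b , eq , keep , paths ← split w i =
    e ◅ a , b , cong suc eq
    , (λ { (p ∷ ps) → p ∷ proj₁ (keep ps) , proj₂ (keep ps) })
    , λ { (p ∷ u) → proj₁ (keep p) ∷ proj₁ (paths u) , proj₂ (paths u) }

  -- Loop erasure: if the source recurs on the path found for the rest, everything before the
  -- recurrence is dropped.
  toPath : ∀ {P x y} → Star (Within P) x y → P x →
           Σ (Walk x y) λ w → IsPath w × All P (vertices w)
  toPath ε px = ε , [] ∷ [] , px ∷ []
  toPath {x = x} ((e , px , py) ◅ s) _ with w , u , ps ← toPath s py with x ∈ˡ? vertices w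
  ... | yes x∈w = let _ , b , _ , keep , paths = split w x∈w in
                  b , proj₂ (paths u) , proj₂ (keep ps)
  ... | no  x∉w = e ◅ w , ¬Any⇒All¬ _ x∉w ∷ u , px ∷ ps

  walk⇒path : ∀ {x y} → Walk x y → Σ (Walk x y) IsPath
  walk⇒path w = let w′ , u , _ = toPath {λ _ → ⊤} (Star.map (λ e → e , tt , tt) w) tt in w′ , u

  extend-path : ∀ {x y z} (w : Walk x y) → IsPath w → z ∉ˡ vertices w → Adj y z →
                Σ (Walk x z) λ w′ → IsPath w′ × edgeCount w′ ≡ suc (edgeCount w) ×
                (∀ {P : Pred Vertex 0ℓ} → All P (vertices w) → P z → All P (vertices w′))
  extend-path ε u z∉ e =
    e ◅ ε , (z∉ ∘ here ∘ sym ∷ []) ∷ [] ∷ [] , refl , λ { (p ∷ []) pz → p ∷ pz ∷ [] }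
  extend-path (e′ ◅ w) (x∉ ∷ u) z∉ e
    with w′ , u′ , eq , keep ← extend-path w u (z∉ ∘ there) e =
    e′ ◅ w′ , keep x∉ (z∉ ∘ here ∘ sym) ∷ u′ , cong suc eq
    , λ { (p ∷ ps) pz → p ∷ keep ps pz }

  lastEdge : ∀ {x y l} (w : Walk x y) → edgeCount w ≡ suc l → ∃ λ p → p ∈ˡ vertices w × Adj p y
  lastEdge (e ◅ ε)        _ = _ , here refl , e
  lastEdge (_ ◅ e′ ◅ w) _ = let p , p∈ , e = lastEdge (e′ ◅ w) refl in p , there p∈ , e

  module _ (acyclic : Acyclic) where

    -- A path from `a` to `b` with at least one edge that avoids `x` would close up through `x` to a
    -- cycle.
    separates : ∀ {x a b} → Adj x a → Adj x b → Star (Within (x ≢_)) a b → a ≡ b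
    separates xa xb s with toPath s (λ x≡a → irreflexive x≡a xa)
    ... | ε          , _ , _  = refl
    ... | w@(_ ◅ _) , u , x∉ =
      contradiction (symmetric xb) (acyclic (xa ◅ w) (x∉ ∷ u) (s≤s (s≤s z≤n)))

    -- The tails of the two paths avoid the source and meet in the target, so `separates` identifies
    -- their first vertices.
    pathLength-unique : ∀ {x y} (w w′ : Walk x y) → IsPath w → IsPath w′ →
                        edgeCount w ≡ edgeCount w′
    pathLength-unique ε        ε         _ _        = refl
    pathLength-unique ε        (_ ◅ w′) _ (x∉ ∷ _) = contradiction (target∈ w′) (All¬⇒¬Any x∉)
    pathLength-unique (_ ◅ w) ε         (x∉ ∷ _) _ = contradiction (target∈ w) (All¬⇒¬Any x∉)
    pathLength-unique (e ◅ w) (e′ ◅ w′) (x∉ ∷ u) (x∉′ ∷ u′)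
      with refl ← separates e e′ (within w x∉ ◅◅ within-reverse (within w′ x∉′)) =
      cong suc (pathLength-unique w w′ u u′)

module Levels (F : RootedForest) where
  open RootedForest F
  open GraphWalks graph

  root : Vertex → Vertex
  root x = proj₁ (rooted x)

  root∈ : ∀ x → root x ∈ roots
  root∈ x = proj₁ (proj₁ (proj₂ (rooted x)))

  root-unique : ∀ {ρ x} → ρ ∈ roots → Walk ρ x → root x ≡ ρ
  root-unique ρ∈ w = proj₂ (proj₂ (rooted _)) (ρ∈ , w)

  pathFromRoot : ∀ x → Σ (Walk (root x) x) IsPath
  pathFromRoot x = walk⇒path (proj₂ (proj₁ (proj₂ (rooted x))))

  rootPath : ∀ x → Walk (root x) x
  rootPath x = proj₁ (pathFromRoot x)

  -- Counts edges, so it is 0 at roots, where `HasLevel` counts vertices and gives 1.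
  level : Vertex → ℕ
  level x = edgeCount (rootPath x)

  hasLevel : ∀ x → HasLevel x (suc (level x))
  hasLevel x = root x , root∈ x , rootPath x , proj₂ (pathFromRoot x) , length-vertices (rootPath x)

  level-unique : ∀ {ρ x} → ρ ∈ roots → (w : Walk ρ x) → IsPath w → level x ≡ edgeCount w
  level-unique {x = x} ρ∈ w u with refl ← root-unique ρ∈ w =
    pathLength-unique acyclic (rootPath x) w (proj₂ (pathFromRoot x)) u

  infix 4 _◂_
  _◂_ : Rel Vertex 0ℓ
  p ◂ x = Adj p x × level x ≡ suc (level p)

  -- If `x` is on the root path of `y`, the remainder of that path is as long as the single edge;
  -- otherwise appending `x` gives a path from the root to `x`. Both cases keep the membership,
  -- which `child∉` and `parent` need.
  adjacent : ∀ {x y} → Adj x y →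
             (x ∈ˡ vertices (rootPath y) × x ◂ y) ⊎ (x ∉ˡ vertices (rootPath y) × y ◂ x)
  adjacent {x} {y} xy with x ∈ˡ? vertices (rootPath y)
  ... | yes x∈ = let a , b , eq , _ , paths = split (rootPath y) x∈
                     ua , ub = paths (proj₂ (pathFromRoot y)) in
    inj₁ (x∈ , xy , (begin
      level y                     ≡⟨ eq ⟩
      edgeCount a + edgeCount b   ≡⟨ cong (edgeCount a +_) (pathLength-unique acyclic b (xy ◅ ε) ub
                                      (((λ x≡y → irreflexive x≡y xy) ∷ []) ∷ [] ∷ [])) ⟩
      edgeCount a + 1             ≡⟨ +-comm (edgeCount a) 1 ⟩
      suc (edgeCount a)           ≡⟨ cong suc (level-unique (root∈ y) a ua) ⟨
      suc (level x)               ∎))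
    where open ≡-Reasoning
  ... | no  x∉ =
    let w , u , eq , _ = extend-path (rootPath y) (proj₂ (pathFromRoot y)) x∉ (symmetric xy) in
    inj₂ (x∉ , symmetric xy , trans (level-unique (root∈ y) w u) eq)

  child∉ : ∀ {p x} → p ◂ x → x ∉ˡ vertices (rootPath p)
  child∉ {p} (px , eq) with adjacent (symmetric px)
  ... | inj₁ (_ , _ , eq′) = contradiction
    (trans eq′ (cong suc (trans eq (sym (+-comm _ 1))))) (m≢1+m+n (level p))
  ... | inj₂ (x∉ , _) = x∉

  -- The root paths of `p` and `q` start at the same root and avoid the child `x`, so they join `p`
  -- to `q` away from `x`, and `separates` applies at `x`.
  parent-unique : ∀ {p q x} → p ◂ x → q ◂ x → p ≡ q
  parent-unique {p} {q} p◂x@(px , _) q◂x@(qx , _)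
    with rootPath p | child∉ p◂x | root-unique (root∈ q) (rootPath q ◅◅ qx ◅ symmetric px ◅ ε)
  ... | w | x∉w | eq = separates acyclic (symmetric px) (symmetric qx)
    (within-reverse (within w (¬Any⇒All¬ _ x∉w)) ◅◅
     subst (λ ρ → Star _ ρ q) (sym eq) (within (rootPath q) (¬Any⇒All¬ _ (child∉ q◂x))))

  parent : ∀ {x l} → level x ≡ suc l → ∃ λ p → p ◂ x
  parent {x} eq with p , p∈ , px ← lastEdge (rootPath x) eq with adjacent px
  ... | inj₁ (_ , p◂x) = p , p◂x
  ... | inj₂ (p∉ , _)  = contradiction p∈ p∉

-- Forests given by a parent relation

record Hierarchy : Set₁ where
  infix 4 _◂_
  field
    order         : ℕ
    nonEmpty      : NonZero order
    _◂_           : Rel (Fin order) 0ℓ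
    _◂?_          : B.Decidable _◂_
    depth         : Fin order → ℕ
    depth-suc     : ∀ {x y} → x ◂ y → depth y ≡ suc (depth x)
    parent        : ∀ {x l} → depth x ≡ suc l → ∃ λ p → p ◂ x
    parent-unique : ∀ {p q x} → p ◂ x → q ◂ x → p ≡ q

  graph : Graph
  graph = record
    { order       = order
    ; nonEmpty    = nonEmpty
    ; Adj         = λ x y → x ◂ y ⊎ y ◂ x
    ; adj?        = λ x y → (x ◂? y) ⊎-dec (y ◂? x)
    ; symmetric   = swap
    ; irreflexive = λ { refl (inj₁ e) → loop e ; refl (inj₂ e) → loop e }
    }
    where
    loop : ∀ {x} → ¬ x ◂ x
    loop e = ℕₚ.1+n≢n (sym (depth-suc e))

  open Graph graph hiding (order; nonEmpty)
  open GraphWalks graph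

  root? : Decidable λ x → depth x ≡ 0
  root? x = depth x ℕ.≟ 0

  -- A path that does not start upwards never turns up later: the only parent of a vertex reached by
  -- a step down is the vertex just left, and a path does not revisit it.
  descending : ∀ {x y} (w : Walk x y) → IsPath w → (∀ {p} → p ◂ x → p ∉ˡ vertices w) →
               depth y ≡ depth x + edgeCount w
  descending ε _ _ = sym (+-identityʳ _)
  descending (inj₂ z◂x ◅ w) _ p∉ = contradiction (there (source∈ w)) (p∉ z◂x)
  descending {x} (inj₁ x◂z ◅ w) (x∉ ∷ u) p∉ = trans
    (descending w u λ p◂z p∈ → All¬⇒¬Any x∉ (subst (_∈ˡ vertices w) (parent-unique p◂z x◂z) p∈))
    (trans (cong (_+ edgeCount w) (depth-suc x◂z)) (sym (+-suc (depth x) _)))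

  ascending : ∀ {x y} (w : Walk x y) → IsPath w → (∀ {p} → p ◂ y → p ∉ˡ vertices w) →
              depth x ≡ depth y + edgeCount w
  ascending ε _ _ = sym (+-identityʳ _)
  ascending {y = y} (inj₂ z◂x ◅ w) (_ ∷ u) p∉ = trans (depth-suc z◂x)
    (trans (cong suc (ascending w u λ p◂y → p∉ p◂y ∘ there)) (sym (+-suc (depth y) _)))
  -- After a first step down to `z` the rest would both ascend and descend, hence be empty, and `x`
  -- would be a parent of `y` on the path.
  ascending {x} {y} (inj₁ x◂z ◅ w) (x∉ ∷ u) p∉ = contradiction (here refl) (p∉ (subst (x ◂_) z≡y x◂z))
    where
    up   = ascending w u λ p◂y → p∉ p◂y ∘ there
    down = descending w u λ p◂z p∈ → All¬⇒¬Any x∉ (subst (_∈ˡ vertices w) (parent-unique p◂z x◂z) p∈)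
    z≡y  = edgeCount≡0 w (ℕₚ.m+n≡0⇒m≡0 _ (ℕₚ.+-cancelˡ-≡ (depth y) _ 0
      (trans (sym (+-assoc (depth y) _ _))
        (trans (cong (_+ edgeCount w) (sym up)) (trans (sym down) (sym (+-identityʳ _)))))))

  -- The path after its first edge avoids `x`, so it descends if it starts at a child of `x` and
  -- ascends if it ends at one. This makes the depths clash for three of the four directions of the
  -- first and the closing edge; in the fourth, two distinct vertices of a path would both be the
  -- parent of `x`.
  acyclic : Acyclic
  acyclic (_ ◅ ε) _ (s≤s ())
  acyclic {x} {y} (e ◅ e′ ◅ w) (x∉ ∷ u) _ yx = cycle e yx
    where
    w′ = e′ ◅ w
    avoid : ∀ {z} → x ◂ z → ∀ {p} → p ◂ z → p ∉ˡ vertices w′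
    avoid x◂z p◂z p∈ = All¬⇒¬Any x∉ (subst (_∈ˡ vertices w′) (parent-unique p◂z x◂z) p∈)
    deeper : x ◂ _ → depth y ≡ suc (suc (depth x + edgeCount w))
    deeper x◂z = trans (descending w′ u (avoid x◂z))
      (trans (cong (_+ suc (edgeCount w)) (depth-suc x◂z)) (cong suc (+-suc (depth x) _)))
    cycle : _ → _ → _
    cycle (inj₁ x◂z) (inj₁ y◂x) = m≢1+m+n (depth y) {suc (suc (edgeCount w))} (begin
      depth y                                  ≡⟨ deeper x◂z ⟩
      2 + (depth x + edgeCount w)              ≡⟨ cong (λ d → 2 + (d + edgeCount w)) (depth-suc y◂x) ⟩
      suc (2 + (depth y + edgeCount w))        ≡⟨ cong suc (trans (+-suc (depth y) _) (cong suc (+-suc (depth y) _))) ⟨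
      suc (depth y + suc (suc (edgeCount w)))  ∎)
      where open ≡-Reasoning
    cycle (inj₁ x◂z) (inj₂ x◂y) =
      m≢1+m+n (depth x) (suc-injective (trans (sym (depth-suc x◂y)) (deeper x◂z)))
    cycle (inj₂ z◂x) (inj₁ y◂x) =
      All.lookup (AllPairs.head u) (target∈ w) (parent-unique z◂x y◂x)
    cycle (inj₂ z◂x) (inj₂ x◂y) = m≢1+m+n (depth x) (begin
      depth x                                 ≡⟨ depth-suc z◂x ⟩
      suc (depth _)                           ≡⟨ cong suc (ascending w′ u (avoid x◂y)) ⟩
      suc (depth y + suc (edgeCount w))       ≡⟨ cong (λ d → suc (d + suc (edgeCount w))) (depth-suc x◂y) ⟩
      suc (suc (depth x + suc (edgeCount w))) ≡⟨ cong suc (+-suc (depth x) _) ⟨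
      suc (depth x + suc (suc (edgeCount w))) ∎)
      where open ≡-Reasoning

  walkFromRoot : ∀ l x → depth x ≡ l → ∃ λ ρ → depth ρ ≡ 0 × Walk ρ x
  walkFromRoot zero    x eq = x , eq , ε
  walkFromRoot (suc l) x eq with p , p◂x ← parent eq
    with ρ , ρ-root , w ← walkFromRoot l p (suc-injective (trans (sym (depth-suc p◂x)) eq)) =
    ρ , ρ-root , w ◅◅ inj₁ p◂x ◅ ε

  path-depth : ∀ {ρ x} → depth ρ ≡ 0 → (w : Walk ρ x) → IsPath w → depth x ≡ edgeCount w
  path-depth {ρ} ρ-root w u = trans
    (descending w u λ p◂ρ → contradiction (trans (sym ρ-root) (depth-suc p◂ρ)) λ ())
    (cong (_+ edgeCount w) ρ-root)

  roots-connected : ∀ {ρ ρ′} → depth ρ ≡ 0 → depth ρ′ ≡ 0 → Walk ρ ρ′ → ρ ≡ ρ′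
  roots-connected r r′ w with w′ , u ← walk⇒path w =
    edgeCount≡0 w′ (trans (sym (path-depth r w′ u)) r′)

  forest : RootedForest
  forest = record
    { graph   = graph
    ; acyclic = acyclic
    ; roots   = comprehension root?
    ; rooted  = λ x → let ρ , r , w = walkFromRoot _ x refl in
        ρ , (∈-comprehension⁺ root? r , w) ,
        λ (r′ , w′) → roots-connected r (∈-comprehension⁻ root? r′) (w ◅◅ Star.reverse swap w′)
    }

  heightLessThan : ∀ {r} → (∀ x → depth x < r) → RootedForest.HeightLessThan forest r
  heightLessThan bound {x = x} ρ∈ w u =
    subst (_< _) (path-depth (∈-comprehension⁻ root? ρ∈) w u) (bound x)

  level⇒depth : ∀ {x l} → RootedForest.HasLevel forest x (suc l) → depth x ≡ l
  level⇒depth (ρ , ρ∈ , w , u , eq) = trans (path-depth (∈-comprehension⁻ root? ρ∈) w u)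
    (suc-injective (trans (sym (length-vertices w)) eq))

-- Winning strategies

module _ {A B : Structure σ} where

  ∈-dom⁺ : ∀ (h : PartialMap A B) {a b} → Maps {A = A} {B} h a b → a ∈ dom {A = A} {B} h
  ∈-dom⁺ h {a} eq = lookup⇒[]= a _ (trans (lookup-map a is-just h) (cong is-just eq))

  ∈-dom⁻ : ∀ (h : PartialMap A B) {a} → a ∈ dom {A = A} {B} h → ∃ (Maps {A = A} {B} h a)
  ∈-dom⁻ h {a} a∈ with lookup h a | trans (sym (lookup-map a is-just h)) ([]=⇒lookup a∈)
  ... | just b | _ = b , refl

  fromChoice : ∀ {Q : Universe A → Universe B → Set} S → (∀ a → a ∈ S → ∃ (Q a)) →
               ∃ λ h → dom {A = A} {B} h ≡ S × (∀ a b → Maps {A = A} {B} h a b → Q a b)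
  fromChoice {Q} S choose = h , ⊆-antisym
    (λ a∈ → let _ , e = ∈-dom⁻ h a∈ in proj₁ (sound _ _ e))
    (λ a∈ → ∈-dom⁺ h (proj₂ (complete a∈))) , λ a b e → proj₂ (sound a b e)
    where
    pick : ∀ {a} → Dec (a ∈ S) → Maybe (Universe B)
    pick (yes a∈) = just (proj₁ (choose _ a∈))
    pick (no  _)  = nothing
    h : PartialMap A B
    h = tabulate λ a → pick (a ∈? S)
    sound : ∀ a b → lookup h a ≡ just b → a ∈ S × Q a b
    sound a b e with a ∈? S | trans (sym (lookup∘tabulate _ a)) e
    ... | yes a∈ | refl = a∈ , proj₂ (choose a a∈)
    complete : ∀ {a} → a ∈ S → ∃ λ b → lookup h a ≡ just b
    complete {a} a∈ with a ∈? S | lookup∘tabulate (λ a → pick (a ∈? S)) a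
    ... | yes _  | eq = _ , eq
    ... | no  a∉ | _  = contradiction a∈ a∉

-- A move `S` of Spoiler is answered by composing `f` with the reply to `image f S`, which asks for
-- no more elements than `S`. It is applied both to the retraction onto the core and to the
-- inclusion of the core.
pullback : ∀ {k} {v : GameVector k} (A C B : Structure σ) → Hom A C →
           WinningStrategy v C B → WinningStrategy v A B
pullback {v = v} A C B (f , f-hom) strategy = record
  { W          = W′
  ; partialHom = λ i h′ (h , w , d , m) → partialHom′ h h′ d m (partialHom i h w)
  ; start      = λ S ∣S∣≤ →
      let h , w , d = start (image f S) (≤-trans (∣image∣ f S) ∣S∣≤)
          g , w′ , _ , d′ = pull h S d w in
      g , w′ , d′
  ; extend     = λ { i g S (h , w , d , m) g⊆S ∣S∣≤ →
      let h′ , w′ , h⊑h′ , d′ = extend i h (image f S) w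
            (λ c∈ → let a , a∈ , eq = ∈-image⁻ f (subst (_ ∈_) d c∈) in
                    subst (_∈ image f S) eq (∈-image⁺ f (g⊆S a∈)))
            (≤-trans (≤-reflexive (cong (λ T → ∣ image f S ─ T ∣) d))
                     (≤-trans (∣image─image∣ f S _) ∣S∣≤))
          g′ , W′g′ , m′ , dg′ = pull h′ S d′ w′ in
      g′ , W′g′
      , (λ a b e → let b′ , e′ = ∈-dom⁻ {A = A} {B} g′
                         (subst (a ∈_) (sym dg′) (g⊆S (∈-dom⁺ {A = A} {B} g e))) in
                   trans e′ (trans (sym (m′ a b′ e′)) (h⊑h′ _ _ (m a b e))))
      , dg′ }
  }
  where
  open WinningStrategy strategy
  domᴬ = dom {A = A} {B}
  domᶜ = dom {A = C} {B}
  Mapsᴬ = Maps {A = A} {B}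
  Mapsᶜ = Maps {A = C} {B}

  W′ : _ → PartialMap A B → Set
  -- The position on `C` is kept with exactly the image as its domain, so that `∣image─image∣`
  -- bounds the next move there.
  W′ i h′ = ∃ λ h → W i h × domᶜ h ≡ image f (domᴬ h′) × (∀ a b → Mapsᴬ h′ a b → Mapsᶜ h (f a) b)

  partialHom′ : ∀ h h′ → domᶜ h ≡ image f (domᴬ h′) → (∀ a b → Mapsᴬ h′ a b → Mapsᶜ h (f a) b) →
                IsPartialHom {A = C} {B} h → IsPartialHom {A = A} {B} h′
  partialHom′ h h′ d m (inj₁ empty) =
    inj₁ λ (a , a∈) → empty (f a , subst (f a ∈_) (sym d) (∈-image⁺ f a∈))
  partialHom′ h h′ d m (inj₂ preserves) = inj₂ λ R t u t↦u r →
    preserves R (Vec.map f t) u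
      (subst (Pointwise _ _) (map-id u) (Pointwise.map⁺ (m _ _) t↦u)) (f-hom R t r)

  pull : ∀ {i} h S → domᶜ h ≡ image f S → W i h →
         ∃ λ g → W′ i g × (∀ a b → Mapsᴬ g a b → Mapsᶜ h (f a) b) × domᴬ g ≡ S
  pull h S d w with g , dg , m ← fromChoice {A = A} {B} S
      (λ a a∈ → ∈-dom⁻ {A = C} {B} h (subst (_ ∈_) (sym d) (∈-image⁺ f a∈))) =
    g , (h , w , trans d (cong (image f) (sym dg)) , m) , m , dg

-- From a decomposition and a strategy to a homomorphism

module Combine {k} {v : GameVector k} (C B : Structure σ)
               (decomposition : VDecomposition v (gaifman C)) (strategy : WinningStrategy v C B) where

  open VDecomposition decomposition
  open RootedForest forest using (Vertex; Adj)
  open Levels forest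
  open IsDecomposition isDecomposition
  open WinningStrategy strategy

  private
    Mapsᶜ = Maps {A = C} {B}
    domᶜ  = dom {A = C} {B}

    Stage : ℕ → PartialMap C B → Set
    Stage l h = ∃ λ i → toℕ i ≡ l × W i h

    Assignment : ℕ → Vertex → Set
    Assignment l x = ∃ λ h → Stage l h × domᶜ h ≡ bag x

    -- The height bound at the child `x` turns the level of its parent into an index of `childBag`.
    child : ∀ {p x l} → p ◂ x → level p ≡ l → Σ (l < k) λ l<k →
            bag p ⊆ bag x × ∣ bag x ─ bag p ∣ ≤ lookup v (suc (fromℕ< l<k))
    child {p} {x} (px , eq) refl = l<k , childBag (fromℕ< l<k) p x px
        (subst (λ l → RootedForest.HasLevel forest p (suc l)) (sym (toℕ-fromℕ< l<k)) (hasLevel p))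
        (subst (λ l → RootedForest.HasLevel forest x (suc l))
          (trans eq (cong suc (sym (toℕ-fromℕ< l<k)))) (hasLevel x))
      where
      l<k : level p < k
      l<k = ℕ.s≤s⁻¹ (subst (_< suc k) eq
        (height (root∈ x) (rootPath x) (proj₂ (pathFromRoot x))))

    grow : ∀ {p x l} → p ◂ x → level p ≡ l → ((g , _) : Assignment l p) →
           Σ (Assignment (suc l) x) λ (g′ , _) → Extends {A = C} {B} g g′
    grow {p} {x} p◂x eq (g , (i , i≡l , w) , d)
      with l<k , p⊆x , small ← child p◂x eq
      with refl ← toℕ-injective {j = inject₁ (fromℕ< l<k)}
             (trans i≡l (sym (trans (toℕ-inject₁ _) (toℕ-fromℕ< l<k))))
      with g′ , w′ , g⊑g′ , d′ ← extend (fromℕ< l<k) g (bag x) w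
             (λ c∈ → p⊆x (subst (_ ∈_) d c∈))
             (subst (λ D → ∣ bag x ─ D ∣ ≤ _) (sym d) small) =
      (g′ , (suc (fromℕ< l<k) , cong suc (toℕ-fromℕ< l<k) , w′) , d′) , g⊑g′

    assign : ∀ l x → level x ≡ l → Assignment l x
    assign zero x eq =
      let h , w , d = start (bag x) (rootBag x (subst (RootedForest.HasLevel forest x ∘ suc) eq (hasLevel x)))
      in h , (zero , refl , w) , d
    assign (suc l) x eq = proj₁ (grow p◂x p-level (assign l _ p-level))
      where
      p◂x = proj₂ (parent eq)
      p-level = suc-injective (trans (sym (proj₂ p◂x)) eq)

    -- `assign` uses the parent found by `parent` and its own proof of the level. These are
    -- exchanged for the given ones, the proofs because equality of natural numbers is
    -- proof-irrelevant.
    grow-extends : ∀ {l p q x} → p ≡ q → (q◂x : q ◂ x) (eq : level p ≡ l) (eq′ : level q ≡ l) →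
                   Extends {A = C} {B} (proj₁ (assign l p eq))
                                       (proj₁ (proj₁ (grow q◂x eq′ (assign l q eq′))))
    grow-extends {l} {p} refl q◂x eq eq′ =
      subst (λ e → Extends {A = C} {B} (proj₁ (assign l p e)) (proj₁ (proj₁ grown)))
        (≡-irrelevant eq′ eq) (proj₂ grown)
      where grown = grow q◂x eq′ (assign l p eq′)

    assign-extends : ∀ {l p x} → p ◂ x → (eq : level p ≡ l) (eq′ : level x ≡ suc l) →
                     Extends {A = C} {B} (proj₁ (assign l p eq)) (proj₁ (assign (suc l) x eq′))
    assign-extends p◂x eq eq′ =
      grow-extends (parent-unique p◂x (proj₂ (parent eq′))) (proj₂ (parent eq′)) eq _

    at : Vertex → PartialMap C B
    at x = proj₁ (assign (level x) x refl)

    dom-at : ∀ x → domᶜ (at x) ≡ bag x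
    dom-at x = proj₂ (proj₂ (assign (level x) x refl))

    at-partialHom : ∀ x → IsPartialHom {A = C} {B} (at x)
    at-partialHom x = let h , (i , _ , w) , _ = assign (level x) x refl in partialHom i h w

    at-assign : ∀ {l} x (eq : level x ≡ l) → at x ≡ proj₁ (assign l x eq)
    at-assign x refl = refl

    at-extends : ∀ {p x} → p ◂ x → Extends {A = C} {B} (at p) (at x)
    at-extends {p} {x} p◂x@(_ , eq) = subst (Extends {A = C} {B} (at p)) (sym (at-assign x eq))
      (assign-extends p◂x refl eq)

    defined : ∀ {c} x → c ∈ bag x → ∃ (Mapsᶜ (at x) c)
    defined x c∈ = ∈-dom⁻ {A = C} {B} (at x) (subst (_ ∈_) (sym (dom-at x)) c∈)

    someBag : Universe C → Vertex
    someBag c = proj₁ (coversVertices c)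

    value : Universe C → Universe B
    value c = proj₁ (defined (someBag c) (proj₂ (coversVertices c)))

    -- Across each edge the position at the child extends the one at the parent, so the value of `c`
    -- persists in both directions as long as `c` stays in the bags.
    transport : ∀ {c b x y} → Star (λ x y → Adj x y × c ∈ bag x × c ∈ bag y) x y →
                Mapsᶜ (at x) c b → Mapsᶜ (at y) c b
    transport ε e = e
    transport ((xy , _ , c∈y) ◅ s) e with adjacent xy
    ... | inj₁ (_ , x◂y) = transport s (at-extends x◂y _ _ e)
    ... | inj₂ (_ , y◂x) = let _ , e′ = defined _ c∈y in
      transport s (trans e′ (trans (sym (at-extends y◂x _ _ e′)) e))

    at-value : ∀ {c} x → c ∈ bag x → Mapsᶜ (at x) c (value c)
    at-value {c} x c∈ = transport (connected c (proj₂ (coversVertices c)) c∈)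
      (proj₂ (defined (someBag c) (proj₂ (coversVertices c))))

    infix 4 _≼_
    -- Ancestry, with the chain read from the descendant upwards, where `parent-unique` leaves no
    -- choice.
    _≼_ : Rel Vertex _
    x ≼ y = Star (flip _◂_) y x

    ≼-linear : ∀ {x y z} → x ≼ z → y ≼ z → x ≼ y ⊎ y ≼ x
    ≼-linear ε        s = inj₂ s
    ≼-linear (e ◅ s) ε  = inj₁ (e ◅ s)
    ≼-linear (e ◅ s) (e′ ◅ s′) with refl ← parent-unique e e′ = ≼-linear s s′

    bag-mono : ∀ {x y} → x ≼ y → bag x ⊆ bag y
    bag-mono ε       c∈ = c∈
    bag-mono (e ◅ s) c∈ = proj₁ (proj₂ (child e refl)) (bag-mono s c∈)

    IsTop : Universe C → Vertex → Set
    IsTop c x = c ∈ bag x × (∀ {p} → p ◂ x → c ∉ bag p)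

    climb : ∀ {c} l x → level x ≡ l → c ∈ bag x → ∃ (IsTop c)
    climb zero x eq c∈ = x , c∈ , λ (_ , eq′) → contradiction (trans (sym eq) eq′) λ ()
    climb {c} (suc l) x eq c∈ with p , p◂x ← parent eq with c ∈? bag p
    ... | yes c∈p = climb l p (suc-injective (trans (sym (proj₂ p◂x)) eq)) c∈p
    ... | no  c∉p = x , c∈ , λ q◂x → subst (λ q → c ∉ bag q) (parent-unique p◂x q◂x) c∉p

    topOf : ∀ c → ∃ (IsTop c)
    topOf c = climb _ (someBag c) refl (proj₂ (coversVertices c))

    top : Universe C → Vertex
    top c = proj₁ (topOf c)

    -- A walk can leave the subtree below `m` only by stepping from `m` to its parent, whose bag
    -- lacks `c`.
    ≼-connected : ∀ {c m x y} → IsTop c m → m ≼ x →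
                  Star (λ x y → Adj x y × c ∈ bag x × c ∈ bag y) x y → m ≼ y
    ≼-connected _ m≼x ε = m≼x
    ≼-connected m-top m≼x ((xy , _ , c∈y) ◅ s) with adjacent xy
    ... | inj₁ (_ , x◂y) = ≼-connected m-top (x◂y ◅ m≼x) s
    ... | inj₂ (_ , y◂x) with m≼x
    ...   | ε        = contradiction c∈y (proj₂ m-top y◂x)
    ...   | e ◅ m≼p with refl ← parent-unique e y◂x = ≼-connected m-top m≼p s

    top≼ : ∀ {c x} → c ∈ bag x → top c ≼ x
    top≼ {c} c∈ = ≼-connected (proj₂ (topOf c)) ε (connected c (proj₁ (proj₂ (topOf c))) c∈)

    Together : Rel (Universe C) _
    Together b c = ∃ λ x → b ∈ bag x × c ∈ bag x

    together⇒comparable : ∀ {b c} → Together b c → top b ≼ top c ⊎ top c ≼ top b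
    together⇒comparable (x , b∈ , c∈) = ≼-linear (top≼ b∈) (top≼ c∈)

    -- Elements sharing a bag have tops that are ancestors of one node, hence comparable, so a
    -- maximal top can be maintained along the tuple.
    deepest : ∀ {m} a (t : Vec (Universe C) m) →
              (∀ {b c} → b ∈ᵛ a ∷ t → c ∈ᵛ a ∷ t → Together b c) →
              ∃ λ d → d ∈ᵛ a ∷ t × (∀ {c} → c ∈ᵛ a ∷ t → top c ≼ top d)
    deepest a [] _ = a , here refl , λ { (here refl) → ε }
    deepest a (a′ ∷ t) clique with d , d∈ , below ← deepest a′ t (λ b∈ c∈ → clique (there b∈) (there c∈))
      with together⇒comparable (clique (here refl) (there d∈))
    ... | inj₁ a≼d = d , there d∈ , λ { (here refl) → a≼d ; (there c∈) → below c∈ }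
    ... | inj₂ d≼a = a , here refl , λ { (here refl) → ε ; (there c∈) → d≼a ◅◅ below c∈ }

    -- Helly property of the subtrees { x ∣ c ∈ bag x }, each of which is determined by its top.
    commonBag : ∀ {m} (t : Vec (Universe C) m) → (∀ {b c} → b ∈ᵛ t → c ∈ᵛ t → Together b c) →
                ∃ λ x → Nonempty (bag x) × (∀ {c} → c ∈ᵛ t → c ∈ bag x)
    commonBag [] _ = someBag point , (point , proj₂ (coversVertices point)) , λ ()
      where
      point : Universe C
      point = inhabitant (Structure.nonEmpty C)
    commonBag (a ∷ t) clique with d , _ , below ← deepest a t clique =
      top d , (d , proj₁ (proj₂ (topOf d))) , λ {c} c∈ → bag-mono (below c∈) (proj₁ (proj₂ (topOf c)))

    tuple-clique : ∀ R t → C ⊨ R ⟨ t ⟩ → ∀ {b c} → b ∈ᵛ t → c ∈ᵛ t → Together b c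
    tuple-clique R t r {b} {c} b∈ c∈ with b ≟ c
    ... | yes refl = someBag b , proj₂ (coversVertices b) , proj₂ (coversVertices b)
    ... | no  b≢c  = coversEdges b c (b≢c , R , t , r , b∈ , c∈)

    pointwise-map : ∀ {m x} (t : Vec (Universe C) m) → (∀ {c} → c ∈ᵛ t → c ∈ bag x) →
                    Pointwise (Mapsᶜ (at x)) t (Vec.map value t)
    pointwise-map []      _  = []
    pointwise-map (c ∷ t) c∈ = at-value _ (c∈ (here refl)) ∷ pointwise-map t (c∈ ∘ there)

  strategy⇒hom : Hom C B
  strategy⇒hom = value , λ R t r →
    let x , (c , c∈) , t⊆ = commonBag t (tuple-clique R t r) in
    -- The bag is non-empty even for a tuple of length 0; a position with empty domain would be free
    -- to violate nullary relations.
    Sum.[ (λ empty → contradiction (c , subst (c ∈_) (sym (dom-at x)) c∈) empty)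
        , (λ preserves → preserves R t _ (pointwise-map t t⊆) r) ]′ (at-partialHom x)

-- The universal structure

lookup-injective : ∀ {xs : List X} → Unique xs → ∀ {i j} → List.lookup xs i ≡ List.lookup xs j → i ≡ j
lookup-injective (x∉ ∷ _) {zero}  {zero}  _  = refl
lookup-injective (x∉ ∷ _) {zero}  {suc j} eq = contradiction eq (All.lookup x∉ (∈-lookup j))
lookup-injective (x∉ ∷ _) {suc i} {zero}  eq = contradiction (sym eq) (All.lookup x∉ (∈-lookup i))
lookup-injective (_ ∷ u)  {suc i} {suc j} eq = cong suc (lookup-injective u eq)

infix 4 _≼_
-- Suffixes of lists: as plays are stored latest move first, these are the prefixes in order of
-- time.
data _≼_ {X : Set} (s : List X) : List X → Set where
  here  : s ≼ s
  there : ∀ {x t} → s ≼ t → s ≼ x ∷ t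

≼-linear : ∀ {s t u : List X} → s ≼ u → t ≼ u → s ≼ t ⊎ t ≼ s
≼-linear here      t≼u       = inj₂ t≼u
≼-linear (there p) here      = inj₁ (there p)
≼-linear (there p) (there q) = ≼-linear p q

≼-dec : DecidableEquality X → (s t : List X) → Dec (s ≼ t)
≼-dec _≟ˣ_ s t with Listₚ.≡-dec _≟ˣ_ s t
... | yes refl = yes here
≼-dec _≟ˣ_ s []      | no s≢ = no λ { here → s≢ refl }
≼-dec _≟ˣ_ s (x ∷ t) | no s≢ = map′ there (λ { here → contradiction refl s≢ ; (there p) → p })
                                          (≼-dec _≟ˣ_ s t)

-- Only non-empty sequences, of length at most the bound, are listed, since the empty play is not a
-- node of the forest; `[]` is put back as a possible tail.
sequences : List X → ℕ → List (List X)
sequences xs zero    = []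
sequences xs (suc m) = cartesianProductWith _∷_ xs ([] ∷ sequences xs m)

∈-sequences⁺ : ∀ {xs : List X} → (∀ x → x ∈ˡ xs) → ∀ {m x s} → length s < m → x ∷ s ∈ˡ sequences xs m
∈-sequences⁺ complete {suc m} {x} {[]}    _       = ∈-cartesianProductWith⁺ _∷_ (complete x) (here refl)
∈-sequences⁺ complete {suc m} {x} {_ ∷ _} (s≤s l) =
  ∈-cartesianProductWith⁺ _∷_ (complete x) (there (∈-sequences⁺ complete l))

∈-sequences⁻ : ∀ (xs : List X) m {s} → s ∈ˡ sequences xs m → ∃₂ λ x t → s ≡ x ∷ t × length t < m
∈-sequences⁻ xs (suc m) s∈ with ∈-cartesianProductWith⁻ _∷_ xs ([] ∷ sequences xs m) s∈
... | x , _ , _ , here refl , refl = x , [] , refl , s≤s z≤n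
... | x , t , _ , there t∈  , refl with _ , _ , refl , l ← ∈-sequences⁻ xs m t∈ =
  x , t , refl , s≤s l

sides : List Side
sides = inside ∷ outside ∷ []

subsets : ∀ n → List (Subset n)
subsets zero    = [] ∷ []
subsets (suc n) = cartesianProductWith _∷_ sides (subsets n)

∈-subsets : ∀ {n} (S : Subset n) → S ∈ˡ subsets n
∈-subsets []            = here refl
∈-subsets (inside  ∷ S) = ∈-cartesianProductWith⁺ _∷_ {xs = sides} (here refl) (∈-subsets S)
∈-subsets (outside ∷ S) = ∈-cartesianProductWith⁺ _∷_ {xs = sides} (there (here refl)) (∈-subsets S)

-- Zero beyond the end of v.
entry : ∀ {m} → Vec ℕ m → ℕ → ℕ
entry []      _       = 0
entry (p ∷ _) zero    = p
entry (_ ∷ v) (suc l) = entry v l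

entry-toℕ : ∀ {m} (v : Vec ℕ m) i → entry v (toℕ i) ≡ lookup v i
entry-toℕ (_ ∷ _) zero    = refl
entry-toℕ (_ ∷ v) (suc i) = entry-toℕ v i

nonZero : ∀ {n} → Fin n → NonZero n
nonZero {suc _} _ = _

∈⇒∣∣≢0 : ∀ {n} {S : Subset n} {x} → x ∈ S → ∣ S ∣ ≢ 0
∈⇒∣∣≢0 {x = x} x∈ eq = ℕₚ.<⇒≢ (≤-trans (s≤s z≤n) (x∈p⇒∣p-x∣<∣p∣ x∈)) (sym eq)

module Universal {k} (v : GameVector k) (C : Structure σ) where

  private n = Structure.size C

  _≟ˢ_ : DecidableEquality (Subset n)
  _≟ˢ_ = ≡-dec Boolₚ._≟_

  -- A play lists the sets of elements newly added by Spoiler, the latest set first.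
  Play : Set
  Play = List (Subset n)

  -- Without duplicates each play has a single index, so that nodes of the forest have unique
  -- parents.
  plays : List Play
  plays = deduplicate (Listₚ.≡-dec _≟ˢ_) (sequences (subsets n) (suc k))

  plays-unique : Unique plays
  plays-unique = DecUnique.deduplicate-! (Listₚ.≡-dec _≟ˢ_) _

  ∈-plays⁺ : ∀ {S s} → length s < suc k → S ∷ s ∈ˡ plays
  ∈-plays⁺ l = ∈-deduplicate⁺ _ (∈-sequences⁺ ∈-subsets l)

  ∈-plays⁻ : ∀ {s} → s ∈ˡ plays → ∃₂ λ S t → s ≡ S ∷ t × length t < suc k
  ∈-plays⁻ s∈ = ∈-sequences⁻ (subsets n) (suc k) (∈-deduplicate⁻ _ _ s∈)

  -- `length s` counts the earlier rounds and so selects the entry of `v` limiting the last move.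
  -- Hence pieces at a given play belong to at most that many elements.
  Legal : Universe C × Play → Set
  Legal (c , [])    = Falsum
  Legal (c , S ∷ s) = c ∈ S × ∣ S ∣ ≤ entry v (length s)

  legal? : Decidable Legal
  legal? (c , [])    = no λ ()
  legal? (c , S ∷ s) = c ∈? S ×-dec ∣ S ∣ ℕ.≤? entry v (length s)

  pieces : List (Universe C × Play)
  pieces = filter legal? (cartesianProduct (allFin n) plays)

  Piece : Set
  Piece = Fin (length pieces)

  element : Piece → Universe C
  element b = proj₁ (List.lookup pieces b)

  play : Piece → Play
  play b = proj₂ (List.lookup pieces b)

  piece : ∀ {S s a} → length s < suc k → a ∈ S → ∣ S ∣ ≤ entry v (length s) →
          ∃ λ b → element b ≡ a × play b ≡ S ∷ s
  piece {S} {s} {a} l a∈ small = Any.index p , cong proj₁ (sym (lookup-index p)) , cong proj₂ (sym (lookup-index p))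
    where
    p : (a , S ∷ s) ∈ˡ pieces
    p = ∈-filter⁺ legal? (∈-cartesianProduct⁺ (∈-allFin a) (∈-plays⁺ l)) (a∈ , small)

  pieces⁻ : ∀ b → List.lookup pieces b ∈ˡ cartesianProduct (allFin n) plays × Legal (List.lookup pieces b)
  pieces⁻ b = ∈-filter⁻ legal? {xs = cartesianProduct (allFin n) plays} (∈-lookup b)

  play∈ : ∀ b → play b ∈ˡ plays
  play∈ b = proj₂ (∈-cartesianProduct⁻ (allFin n) plays (proj₁ (pieces⁻ b)))

  legal : ∀ b → Legal (element b , play b)
  legal b = proj₂ (pieces⁻ b)

  Chain : ∀ {m} → Vec Piece m → Set
  Chain u = ∀ i j → play (lookup u i) ≼ play (lookup u j) ⊎ play (lookup u j) ≼ play (lookup u i)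

  Rel? : ∀ R u → Dec (C ⊨ R ⟨ Vec.map element u ⟩ × Chain u)
  Rel? R u = T? _ ×-dec all? λ i → all? λ j → ≼-dec _≟ˢ_ _ _ ⊎-dec ≼-dec _≟ˢ_ _ _

  module _ (inhabited : NonZero (length pieces)) where

    B : Structure σ
    B = record { size = length pieces ; nonEmpty = inhabited ; rel = λ R u → ⌊ Rel? R u ⌋ }

    -- Duplicator's strategy on the universal structure

    private
      Mapsᶜ = Maps {A = C} {B}
      domᶜ  = dom {A = C} {B}

    -- Duplicator's invariant: every element is answered by a copy of itself, and all copies lie
    -- along one play, which makes them pairwise comparable.
    Follows : Play → PartialMap C B → Set
    Follows s h = ∀ a b → Mapsᶜ h a b → element b ≡ a × play b ≼ s

    -- Old elements keep their pieces; new ones get the piece at the play prolonged by `S ─ domᶜ h`,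
    -- the set whose size the game limits. The opening move is the case of the empty play and the
    -- map `nowhere`.
    advance : ∀ s h S → Follows s h → length s < suc k → domᶜ h ⊆ S →
              ∣ S ─ domᶜ h ∣ ≤ entry v (length s) →
              ∃ λ h′ → Follows ((S ─ domᶜ h) ∷ s) h′ × Extends {A = C} {B} h h′ × domᶜ h′ ≡ S
    advance s h S follows l h⊆S small =
      let h′ , d , m = fromChoice {A = C} {B} S choose in
      h′ , (λ a b e → answer-follows (m a b e))
      , (λ a b e → let b′ , e′ = ∈-dom⁻ {A = C} {B} h′
                         (subst (a ∈_) (sym d) (h⊆S (∈-dom⁺ {A = C} {B} h e))) in
                   trans e′ (sym (trans (sym e) (old (m a b′ e′) (∈-dom⁺ {A = C} {B} h e)))))
      , d
      where
      S₊ = S ─ domᶜ h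
      Answer : Universe C → Piece → Set
      -- Recording `a ∉ domᶜ h` is what lets `old` show that the new map extends `h`.
      Answer a b = Mapsᶜ h a b ⊎ (a ∉ domᶜ h × element b ≡ a × play b ≡ S₊ ∷ s)
      choose : ∀ a → a ∈ S → ∃ (Answer a)
      choose a a∈ with a ∈? domᶜ h
      ... | yes a∈h = let b , e = ∈-dom⁻ {A = C} {B} h a∈h in b , inj₁ e
      ... | no  a∉h = let b , eq = piece l (x∈p∧x∉q⇒x∈p─q a∈ a∉h) small in b , inj₂ (a∉h , eq)
      answer-follows : ∀ {a b} → Answer a b → element b ≡ a × play b ≼ S₊ ∷ s
      answer-follows (inj₁ e) = let eq , p = follows _ _ e in eq , there p
      answer-follows (inj₂ (_ , eq , eq′)) = eq , subst (_≼ S₊ ∷ s) (sym eq′) here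
      old : ∀ {a b} → Answer a b → a ∈ domᶜ h → Mapsᶜ h a b
      old (inj₁ e)         _   = e
      old (inj₂ (a∉ , _)) a∈ = contradiction a∈ a∉

    follows⇒partialHom : ∀ s h → Follows s h → IsPartialHom {A = C} {B} h
    follows⇒partialHom s h follows = inj₂ λ R t u t↦u r → fromWitness {a? = Rel? R u}
      ( subst (C ⊨ R ⟨_⟩) (sym (elements t↦u)) r
      , λ i j → ≼-linear (proj₂ (follows _ _ (Pointwise.lookup t↦u i)))
                         (proj₂ (follows _ _ (Pointwise.lookup t↦u j))))
      where
      elements : ∀ {m} {t : Vec _ m} {u : Vec _ m} → Pointwise (Mapsᶜ h) t u → Vec.map element u ≡ t
      elements []        = refl
      elements (e ∷ t↦u) = cong₂ _∷_ (proj₁ (follows _ _ e)) (elements t↦u)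

    nowhere : PartialMap C B
    nowhere = Vec.replicate n nothing

    strategy : WinningStrategy v C B
    strategy = record
      { W          = λ i h → ∃ λ s → length s ≡ suc (toℕ i) × Follows s h
      ; partialHom = λ { i h (s , _ , follows) → follows⇒partialHom s h follows }
      ; start      = λ S ∣S∣≤ →
          let h , follows , _ , d = advance [] nowhere S
                (λ a b e → contradiction (trans (sym (lookup-replicate a nothing)) e) λ ())
                (s≤s z≤n)
                (λ {a} a∈ → contradiction (subst (a ∈_) (map-replicate is-just _ n) a∈) ∉⊥)
                (≤-trans (∣p─q∣≤∣p∣ S _) (≤-trans ∣S∣≤ (≤-reflexive (sym (entry-toℕ v zero)))))
          in h , (_ , refl , follows) , d
      ; extend     = λ { i g S (s , eq , follows) g⊆S small →
          let eq′ = trans eq (cong suc (toℕ-inject₁ i))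
              h , follows′ , g⊑h , d = advance s g S follows
                (subst (_< suc k) (sym eq′) (s≤s (toℕ<n i))) g⊆S
                (≤-trans small (≤-reflexive (trans (sym (entry-toℕ v (suc i))) (cong (entry v) (sym eq′)))))
          in h , (_ , cong suc eq′ , follows′) , g⊑h , d }
      }

    element-isHom : IsHom B C element
    element-isHom R u r = proj₁ (toWitness {a? = Rel? R u} r)

    -- The decomposition read off from a homomorphism to the universal structure

    module _ (f : Universe C → Piece) (f-isHom : IsHom C B f)
             (f₀-injective : Injective _≡_ _≡_ (element ∘ f)) where

      node : Universe C → Play
      node = play ∘ f

      decode : Fin (length plays) → Play
      decode = List.lookup plays

      encode : ∀ {s} → s ∈ˡ plays → Fin (length plays)
      encode = Any.index

      decode-encode : ∀ {s} (s∈ : s ∈ˡ plays) → decode (encode s∈) ≡ s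
      decode-encode s∈ = sym (lookup-index s∈)

      decode⁻ : ∀ x → ∃₂ λ S t → decode x ≡ S ∷ t × length t < suc k
      decode⁻ x = ∈-plays⁻ (∈-lookup {xs = plays} x)

      nonempty : ∀ {s} → s ∈ˡ plays → s ≢ []
      nonempty s∈ eq with _ , _ , eq′ , _ ← ∈-plays⁻ s∈ = contradiction (trans (sym eq) eq′) λ ()

      infix 4 _◂_
      _◂_ : Rel (Fin (length plays)) _
      x ◂ y = ∃ λ S → decode y ≡ S ∷ decode x

      _◂?_ : ∀ x y → Dec (x ◂ y)
      x ◂? y with decode y
      ... | []    = no λ ()
      ... | S ∷ t = map′ (λ eq → S , cong (S ∷_) eq) (λ { (_ , eq) → Listₚ.∷-injectiveʳ eq })
                         (Listₚ.≡-dec _≟ˢ_ t (decode x))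

      -- The roots are the plays of length 1, hence the predecessor.
      depth : Fin (length plays) → ℕ
      depth x = pred (length (decode x))

      length-decode : ∀ x → length (decode x) ≡ suc (depth x)
      length-decode x with _ , _ , eq , _ ← decode⁻ x rewrite eq = refl

      hierarchy : Hierarchy
      hierarchy = record
        { order         = length plays
        ; nonEmpty      = nonZero (encode (∈-plays⁺ {⊥} {[]} (s≤s z≤n)))
        ; _◂_           = _◂_
        ; _◂?_          = _◂?_
        ; depth         = depth
        ; depth-suc     = λ { {x} (_ , eq) → trans (cong (pred ∘ length) eq) (length-decode x) }
        ; parent        = λ {x} → parent x
        ; parent-unique = λ { (_ , eq) (_ , eq′) →
            lookup-injective plays-unique (Listₚ.∷-injectiveʳ (trans (sym eq) eq′)) }
        }
        where
        parent : ∀ x {l} → depth x ≡ suc l → ∃ λ p → p ◂ x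
        parent x eq with decode⁻ x
        ... | _ , []    , eq′ , _ = contradiction (trans (sym eq) (cong (pred ∘ length) eq′)) λ ()
        ... | S , t@(_ ∷ _) , eq′ , l =
          let t∈ = ∈-plays⁺ (ℕₚ.<-trans (ℕₚ.n<1+n _) l) in
          encode t∈ , S , trans eq′ (cong (S ∷_) (sym (decode-encode t∈)))

      open Hierarchy hierarchy using (graph; forest; heightLessThan; level⇒depth)

      bag? : ∀ x → Decidable λ c → node c ≼ decode x
      bag? x c = ≼-dec _≟ˢ_ (node c) (decode x)

      bag : Fin (length plays) → Subset n
      bag x = comprehension (bag? x)

      home : Universe C → Fin (length plays)
      home c = encode (play∈ (f c))

      decode-home : ∀ c → decode (home c) ≡ node c
      decode-home c = decode-encode (play∈ (f c))

      ∈-bag-home : ∀ {b c} → node b ≼ node c → b ∈ bag (home c)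
      ∈-bag-home {b} {c} p =
        ∈-comprehension⁺ (bag? (home c)) (subst (node b ≼_) (sym (decode-home c)) p)

      Shared : Universe C → Rel (Fin (length plays)) _
      Shared c = GraphWalks.Within graph λ x → c ∈ bag x

      -- Forgetting the latest moves one by one stays in bags containing `c` until the play of `f c`
      -- is reached. Thus all nodes with `c` in their bag are joined to `home c`.
      walkHome : ∀ c x {s} → decode x ≡ s → node c ≼ s → Star (Shared c) x (home c)
      walkHome c x eq here
        with refl ← lookup-injective plays-unique {x} {home c} (trans eq (sym (decode-home c))) = ε
      walkHome c x {S ∷ []} eq (there c≼) with node c | play∈ (f c) | c≼
      ... | _ | c∈ | here = contradiction refl (nonempty c∈)
      walkHome c x {S ∷ t@(_ ∷ _)} eq (there c≼) =
        (inj₂ (S , trans eq (cong (S ∷_) (sym (decode-encode t∈))))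
        , ∈-comprehension⁺ (bag? x) (subst (node c ≼_) (sym eq) (there c≼))
        , ∈-comprehension⁺ (bag? p) (subst (node c ≼_) (sym (decode-encode t∈)) c≼))
        ◅ walkHome c p (decode-encode t∈) c≼
        where
        t∈ : t ∈ˡ plays
        t∈ with _ , _ , eq′ , l ← decode⁻ x with refl ← trans (sym eq) eq′ =
          ∈-plays⁺ (ℕₚ.<-trans (ℕₚ.n<1+n _) l)
        p = encode t∈

      isDecomposition : IsDecomposition graph (gaifman C) bag
      isDecomposition = record
        { coversVertices = λ c → home c , ∈-bag-home here
        -- The images of adjacent elements occur in one tuple of `B`, so their plays are comparable,
        -- and the node of the longer play has both elements in its bag.
        ; coversEdges    = λ { b c (_ , R , t , r , b∈ , c∈) →
            Sum.[ (λ p → home c , ∈-bag-home p , ∈-bag-home here)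
                , (λ p → home b , ∈-bag-home here , ∈-bag-home p) ]′
              (comparable R t r b∈ c∈) }
        ; connected      = λ c {x} {y} x∋c y∋c →
            walk x∋c ◅◅ GraphWalks.within-reverse graph (walk y∋c)
        }
        where
        walk : ∀ {c x} → c ∈ bag x → Star (Shared c) x (home c)
        walk {c} {x} x∋c = walkHome c x refl (∈-comprehension⁻ (bag? x) x∋c)
        comparable : ∀ R t → C ⊨ R ⟨ t ⟩ → ∀ {b c} → b ∈ᵛ t → c ∈ᵛ t → node b ≼ node c ⊎ node c ≼ node b
        comparable R t r b∈ c∈ = subst₂ (λ b c → play b ≼ play c ⊎ play c ≼ play b)
          (at b∈) (at c∈) (proj₂ (toWitness {a? = Rel? R (Vec.map f t)} (f-isHom R t r)) _ _)
          where
          at : ∀ {c} (c∈ : c ∈ᵛ t) → lookup (Vec.map f t) (Anyᵛ.index c∈) ≡ f c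
          at c∈ = trans (lookup-map (Anyᵛ.index c∈) f t) (cong f (sym (Anyᵛₚ.lookup-index c∈)))

      -- f maps D injectively into the pieces placed at the single node S ∷ s.
      ∣fibre∣≤ : ∀ (D : Subset n) S s → (∀ {c} → c ∈ D → node c ≡ S ∷ s) → ∣ D ∣ ≤ entry v (length s)
      ∣fibre∣≤ D S s at with nonempty? D
      -- The bound on `S` is only known from a piece placed at `S ∷ s`, so an empty `D` is treated
      -- apart.
      ... | no  empty = subst (_≤ _) (sym (trans (cong ∣_∣ (Empty-unique empty)) (∣⊥∣≡0 n))) z≤n
      ... | yes (c , c∈) = ≤-trans
        (∣image∣≤ (λ a c → element (f c) ≡ a) (λ a c → element (f c) ≟ a)
          (λ eq eq′ → f₀-injective (trans eq (sym eq′))) S D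
          λ {c} c∈ → element (f c) , proj₁ (legalAt c∈) , refl)
        (proj₂ (legalAt c∈))
        where
        legalAt : ∀ {c} → c ∈ D → Legal (element (f c) , S ∷ s)
        legalAt {c} c∈ = subst (λ t → Legal (element (f c) , t)) (at c∈) (legal (f c))

      decomposition : VDecomposition v (gaifman C)
      decomposition = record
        { forest          = forest
        ; height          = heightLessThan λ x → let _ , _ , eq , l = decode⁻ x in
                              subst (_< suc k) (sym (cong (pred ∘ length) eq)) l
        ; bag             = bag
        ; isDecomposition = isDecomposition
        ; rootBag         = λ x level → rootBag x (level⇒depth level)
        ; childBag        = λ i x y xy level level′ →
                              childBag i x y xy (level⇒depth level) (level⇒depth level′)
        }
        where
        rootBag : ∀ x → depth x ≡ 0 → ∣ bag x ∣ ≤ lookup v zero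
        rootBag x eq with decode⁻ x
        ... | _ , _ ∷ _ , eq′ , _ = contradiction (trans (sym eq) (cong (pred ∘ length) eq′)) λ ()
        ... | S , []    , eq′ , _ = ≤-trans
          (∣fibre∣≤ (bag x) S [] λ {c} c∈ →
            only c (subst (node c ≼_) eq′ (∈-comprehension⁻ (bag? x) c∈)))
          (≤-reflexive (entry-toℕ v zero))
          where
          only : ∀ c → node c ≼ S ∷ [] → node c ≡ S ∷ []
          only c c≼ with node c | play∈ (f c) | c≼
          ... | _ | _  | here       = refl
          ... | _ | c∈ | there here = contradiction refl (nonempty c∈)

        childBag : ∀ (i : Fin k) x y → x ◂ y ⊎ y ◂ x → depth x ≡ toℕ i → depth y ≡ suc (toℕ i) →
                   bag x ⊆ bag y × ∣ bag y ─ bag x ∣ ≤ lookup v (suc i)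
        childBag i x y (inj₂ y◂x) eq eq′ = contradiction
          (trans (sym eq) (trans (Hierarchy.depth-suc hierarchy y◂x) (cong suc eq′)))
          (ℕₚ.m≢1+m+n _ ∘ flip trans (cong suc (ℕₚ.+-comm 1 _)))
        childBag i x y (inj₁ (S , yx)) eq eq′ =
          (λ {c} c∈ → ∈-comprehension⁺ (bag? y)
            (subst (node c ≼_) (sym yx) (there (∈-comprehension⁻ (bag? x) c∈))))
          , ≤-trans
            -- A prefix of the play at `y` that is no prefix of the play at `x` is the whole play at
            -- `y`, so all new elements have their pieces there.
            (∣fibre∣≤ (bag y ─ bag x) S (decode x) λ {c} c∈ →
              new c (λ c≼ → x∈p─q⇒x∉q (bag y) (bag x) c∈ (∈-comprehension⁺ (bag? x) c≼))
                (subst (node c ≼_) yx (∈-comprehension⁻ (bag? y) (p─q⊆p (bag y) (bag x) c∈))))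
            (≤-reflexive (trans (cong (entry v) (trans (length-decode x) (cong suc eq)))
                                (entry-toℕ v (suc i))))
          where
          new : ∀ c → ¬ node c ≼ decode x → node c ≼ S ∷ decode x → node c ≡ S ∷ decode x
          new c c⋠ c≼ with node c | c⋠ | c≼
          ... | _ | _  | here     = refl
          ... | _ | c⋠ | there c≼ = contradiction c≼ c⋠

-- The equivalence for a structure and its core

hom-∘ : ∀ {A B C : Structure σ} → Hom A B → Hom B C → Hom A C
hom-∘ {C = C} (f , f-hom) (g , g-hom) = g ∘ f , λ R t r →
  subst (C ⊨ R ⟨_⟩) (sym (map-∘ g f t)) (g-hom R _ (f-hom R t r))

piecesExist : ∀ {k} (v : GameVector k) (C : Structure σ) i → lookup v i ≢ 0 →
              NonZero (length (Universal.pieces v C))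
-- Spoiler plays empty sets until the round with the non-zero entry and then a singleton.
piecesExist {k = k} v C i p≢0 = nonZero (proj₁ (Universal.piece v C {⁅ c ⁆} {replicate (toℕ i) ⊥}
  (subst (_< suc k) (sym length-s) (toℕ<n i)) (x∈⁅x⁆ c)
  (subst₂ _≤_ (sym (∣⁅x⁆∣≡1 c)) (sym (trans (cong (entry v) length-s) (entry-toℕ v i)))
    (ℕₚ.n≢0⇒n>0 p≢0))))
  where
  c = inhabitant (Structure.nonEmpty C)
  length-s = Listₚ.length-replicate (toℕ i)

point : Structure σ
point = record { size = 1 ; nonEmpty = _ ; rel = λ _ _ → false }

-- If all entries are 0, Spoiler can only ever ask for the empty set, and the empty map is a partial
-- homomorphism by definition.
pointStrategy : ∀ {k} (v : GameVector k) (A : Structure σ) → (∀ i → lookup v i ≡ 0) →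
                WinningStrategy v A point
pointStrategy v A v≡0 = record
  { W          = λ _ h → Empty (dom {A = A} {point} h)
  ; partialHom = λ _ _ → inj₁
  ; start      = λ S ∣S∣≤ → respond S λ (_ , x∈) →
      ∈⇒∣∣≢0 x∈ (ℕₚ.n≤0⇒n≡0 (≤-trans ∣S∣≤ (≤-reflexive (v≡0 zero))))
  ; extend     = λ i g S empty g⊆S small →
      let h , empty′ , d = respond S λ (x , x∈) →
            ∈⇒∣∣≢0 (x∈p∧x∉q⇒x∈p─q x∈ λ x∈g → empty (x , x∈g))
                    (ℕₚ.n≤0⇒n≡0 (≤-trans small (≤-reflexive (v≡0 (suc i)))))
      in h , empty′ , (λ a b e → contradiction (a , ∈-dom⁺ {A = A} {point} g e) empty) , d
  }
  where
  respond : ∀ S → Empty S → ∃ λ h → Empty (dom {A = A} {point} h) × dom {A = A} {point} h ≡ S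
  respond S empty = let h , d , _ = fromChoice {A = A} {point} {λ _ _ → Falsum} S
                                      (λ a a∈ → contradiction (a , a∈) empty) in
                    h , subst Empty (sym d) empty , d

module _ (A : Structure σ) {k} (v : GameVector k) (C : Structure σ) (C-core : C IsCoreOf A) where
  open _IsCoreOf_ C-core

  solves⇒decomposition : Solves-p-HOM v ｛ σ , A ｝ → (∃ λ i → lookup v i ≢ 0) →
                          VDecomposition v (gaifman C)
  solves⇒decomposition solves (i , p≢0) =
    Universal.decomposition v C inhabited f f-hom
      -- `f` followed by the projection of pieces to their elements is an endomorphism of the core
      -- `C`, hence injective.
      (isCore _ (proj₂ (hom-∘ {A = C} {B} {C} (f , f-hom) (_ , Universal.element-isHom v C inhabited))))
    where
    inhabited = piecesExist v C i p≢0
    B = Universal.B v C inhabited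
    fhom : Hom C B
    -- The game is solved for `A` rather than `C`: Duplicator's strategy is pulled back to `A` along
    -- the retraction, and the resulting homomorphism is restricted to `C`.
    fhom = hom-∘ {A = C} {A} {B} (ι , ι-isHom)
      (solves σ A refl B (pullback A C B retraction (Universal.strategy v C inhabited)))
    f = proj₁ fhom
    f-hom = proj₂ fhom

  -- For the all-zero vector Duplicator wins on `point`, but a tuple of `A` has nowhere to go there,
  -- since all relations of `point` are empty.
  nonzeroEntry : NonDegenerate v A → Solves-p-HOM v ｛ σ , A ｝ → ∃ λ i → lookup v i ≢ 0
  nonzeroEntry (inj₁ p) _ = p
  nonzeroEntry (inj₂ (R , t , r)) solves with any? (λ i → ¬? (lookup v i ℕ.≟ 0))
  ... | yes p = p
  ... | no ¬p = contradiction r (proj₂ (solves σ A refl point (pointStrategy v A λ i →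
                  decidable-stable (lookup v i ℕ.≟ 0) λ p≢0 → ¬p (i , p≢0))) R t)

theorem6p1 : ∀ {σ : Vocabulary} (A : Structure σ) {k} (v : GameVector k) →
    NonDegenerate v A →
    ∀ (C : Structure σ) → C IsCoreOf A →
    Solves-p-HOM v ｛ σ , A ｝ ⇔ VDecomposition v (gaifman C)
theorem6p1 A v nonDegenerate C C-core = mk⇔
  (λ solves → solves⇒decomposition A v C C-core solves (nonzeroEntry A v C C-core nonDegenerate solves))
  (λ { decomposition _ _ refl B strategy → hom-∘ {A = A} {C} {B} retraction
       (Combine.strategy⇒hom C B decomposition (pullback C A B (ι , ι-isHom) strategy)) })
  where open _IsCoreOf_ C-core
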